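{- Let $k_0\in\mathbb{Q}$ be such that $x^{3}-k_0x^{2}+(k_0-3)x+1$ is irreducible over $\mathbb{Q}$, and let $\alpha$ be one of its roots. An element $\omega$ of $\mathbb{Q}(\alpha)$ belongs to the $y$-class if and only if $\omega$ is a root of an irreducible (over $\mathbb{Q}$) polynomial of the form $x^{3}-kx^{2}+(k-3)x+1$ for some rational number $k$.
   Context: Let $y$ denote the linear fractional transformation $y(z)=\frac{z-1}{z}$ (so $y^2(z)=\frac{ -1}{z-1}$ and $y^3(z)=z$). An element $\omega$ of a cubic number field is said to belong to the $y$-class if $\omega\notin\mathbb{Q}$ and all conjugates of $\omega$ over $\mathbb{Q}$ are obtained by applying powers of $y$ to $\omega$, i.e. the conjugates of $\omega$ are exactly $\omega$, $\frac{\omega-1}{\omega}$ and $\frac{ -1}{\omega-1}$. -}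

module Defs where

open import Data.Rational using (ℚ; _+_; _*_; -_; _-_; 0ℚ; 1ℚ)
open import Data.Product using (Σ; ∃; _×_; _,_)
open import Relation.Binary.PropositionalEquality using (_≡_)
open import Relation.Nullary using (¬_)

-- A monic rational cubic  x³ + p x² + q x + r, stored as its coefficients (p , q , r).
record MonicCubic : Set where
  constructor cubic
  field
    p q r : ℚ

fam : ℚ → MonicCubic
fam k = cubic (- k) (k - 3ℚ) 1ℚ
  where
  3ℚ : ℚ
  3ℚ = 1ℚ + 1ℚ + 1ℚ

-- Irreducible over ℚ: a (monic) cubic is reducible iff it is a product of a
-- degree-1 and a degree-2 rational polynomial
--   (a₁ x + a₀)(b₂ x² + b₁ x + b₀),
-- so irreducible means no such factorisation exists.
Irreducible : MonicCubic → Set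
Irreducible (cubic p q r) =
  ¬ (Σ ℚ λ a₁ → Σ ℚ λ a₀ → Σ ℚ λ b₂ → Σ ℚ λ b₁ → Σ ℚ λ b₀ →
       (a₁ * b₂ ≡ 1ℚ) × (a₁ * b₁ + a₀ * b₂ ≡ p) ×
       (a₁ * b₀ + a₀ * b₁ ≡ q) × (a₀ * b₀ ≡ r))

-- The field ℚ(α) where α is a root of the irreducible cubic  fam k₀,
-- modelled as ℚ[x]/(fam k₀): elements c₀ + c₁ α + c₂ α² with rational c's
-- (1, α, α² is a ℚ-basis, so equality is componentwise).
record K (k₀ : ℚ) : Set where
  constructor ⟨_,_,_⟩
  field
    c₀ c₁ c₂ : ℚ

module Field (k₀ : ℚ) where

  -- α³ = s₂ α² + s₁ α + s₀  (from α³ - k₀ α² + (k₀ - 3) α + 1 = 0)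
  private
    s₂ s₁ s₀ : ℚ
    s₂ = - MonicCubic.p (fam k₀)
    s₁ = - MonicCubic.q (fam k₀)
    s₀ = - MonicCubic.r (fam k₀)

  emb : ℚ → K k₀
  emb a = ⟨ a , 0ℚ , 0ℚ ⟩

  αK : K k₀
  αK = ⟨ 0ℚ , 1ℚ , 0ℚ ⟩

  _⊕_ : K k₀ → K k₀ → K k₀
  ⟨ a₀ , a₁ , a₂ ⟩ ⊕ ⟨ b₀ , b₁ , b₂ ⟩ = ⟨ a₀ + b₀ , a₁ + b₁ , a₂ + b₂ ⟩

  ⊖_ : K k₀ → K k₀
  ⊖ ⟨ a₀ , a₁ , a₂ ⟩ = ⟨ - a₀ , - a₁ , - a₂ ⟩

  _⊝_ : K k₀ → K k₀ → K k₀
  a ⊝ b = a ⊕ (⊖ b)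

  _⊗_ : K k₀ → K k₀ → K k₀
  ⟨ a₀ , a₁ , a₂ ⟩ ⊗ ⟨ b₀ , b₁ , b₂ ⟩ =
    ⟨ d₀ + s₀ * e₃ , d₁ + s₀ * d₄ + s₁ * e₃ , d₂ + s₁ * d₄ + s₂ * e₃ ⟩
    where
    d₀ d₁ d₂ d₃ d₄ e₃ : ℚ
    d₀ = a₀ * b₀
    d₁ = a₀ * b₁ + a₁ * b₀
    d₂ = a₀ * b₂ + a₁ * b₁ + a₂ * b₀
    d₃ = a₁ * b₂ + a₂ * b₁
    d₄ = a₂ * b₂
    -- α⁴ = s₂ α³ + s₁ α² + s₀ α, so the α⁴ part first moves to α³, α², α
    e₃ = d₃ + s₂ * d₄

  infixl 6 _⊕_ _⊝_
  infixl 7 _⊗_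

  IsRoot : MonicCubic → K k₀ → Set
  IsRoot (cubic p q r) ω =
    (ω ⊗ ω ⊗ ω) ⊕ (emb p ⊗ ω ⊗ ω) ⊕ (emb q ⊗ ω) ⊕ emb r ≡ emb 0ℚ

  -- y-class: ω ∉ ℚ, and the conjugates of ω (the roots, with multiplicity, of
  -- its minimal polynomial over ℚ) are exactly ω, y(ω) = (ω-1)/ω and
  -- y²(ω) = -1/(ω-1).  Here u = y(ω) is characterised by u·ω = ω - 1 and
  -- v = y²(ω) by v·(ω - 1) = -1; the minimal polynomial is a monic
  -- irreducible rational polynomial P with
  --   P(x) = (x - ω)(x - u)(x - v)   in ℚ(α)[x]
  -- (compared coefficientwise; such P has degree 3 and vanishes at ω).
  YClass : K k₀ → Set
  YClass ω =
    (¬ (Σ ℚ λ a → ω ≡ emb a)) ×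
    (Σ (K k₀) λ u → Σ (K k₀) λ v →
       (u ⊗ ω ≡ ω ⊝ emb 1ℚ) × (v ⊗ (ω ⊝ emb 1ℚ) ≡ emb (- 1ℚ)) ×
       Σ MonicCubic λ P → Irreducible P ×
         (emb (MonicCubic.p P) ≡ ⊖ (ω ⊕ u ⊕ v)) ×
         (emb (MonicCubic.q P) ≡ ω ⊗ u ⊕ u ⊗ v ⊕ v ⊗ ω) ×
         (emb (MonicCubic.r P) ≡ ⊖ (ω ⊗ u ⊗ v)))

-- If u = y(ω) and v = y²(ω), i.e. uω = ω - 1 and v(ω - 1) = -1, then ωuv = -1,
-- so ω is a unit, and multiplying by ω shows ωu + uv + vω = (ω + u + v) - 3.
-- Hence (x - ω)(x - u)(x - v) = x³ - kx² + (k - 3)x + 1 with k = ω + u + v, and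
-- when this product is a rational polynomial, k is rational.  Conversely, for a
-- root ω of an irreducible x³ - kx² + (k - 3)x + 1 the cubic itself expresses
-- ω⁻¹ as a polynomial in ω, which yields y(ω) and y²(ω) in ℚ(α); their
-- symmetric functions are the coefficients of the cubic, and ω is not rational
-- since an irreducible cubic has no rational root.
module Submission where

open import Defs
open import Algebra.Bundles using (CommutativeRing)
open import Algebra.Structures using (IsCommutativeRing)
open import Algebra.Solver.Ring.AlmostCommutativeRing
  using (fromCommutativeRing; _-Raw-AlmostCommutative⟶_)
import Algebra.Properties.Ring as RingProperties
import Algebra.Solver.Ring
open import Data.Fin using (zero; suc)
open import Data.Maybe using (map)
open import Data.Product using (Σ; _×_; _,_)
open import Data.Rational using (ℚ; _+_; _*_; -_; _-_; 0ℚ; 1ℚ)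
open import Data.Rational.Properties using (_≟_; +-*-rawRing; +-*-ring; +-identityʳ)
open import Data.Rational.Solver using (module +-*-Solver)
open import Data.Vec using (Vec; []; _∷_)
open import Function.Bundles using (_⇔_; mk⇔)
open import Relation.Binary.Consequences using (dec⇒weaklyDec)
open import Relation.Binary.PropositionalEquality
open import Relation.Nullary using (¬_)
open ≡-Reasoning

3ℚ : ℚ
3ℚ = 1ℚ + 1ℚ + 1ℚ

open RingProperties +-*-ring using () renaming (-‿involutive to neg-involutive)

cong₃ : ∀ {A B C D : Set} (f : A → B → C → D) {a a′ b b′ c c′} →
        a ≡ a′ → b ≡ b′ → c ≡ c′ → f a b c ≡ f a′ b′ c′
cong₃ f refl refl refl = refl

root⇒reducible : ∀ p q r a → a * a * a + p * a * a + q * a + r ≡ 0ℚ → ¬ Irreducible (cubic p q r)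
root⇒reducible p q r a value≡0 irreducible =
  irreducible (1ℚ , - a , 1ℚ , a + p , a * a + p * a + q , refl , linear , constant , unit)
  where
  open +-*-Solver using (solve; _:=_; _:+_; _:*_; :-_; con)
  linear : 1ℚ * (a + p) + - a * 1ℚ ≡ p
  linear = solve 2 (λ a p → con 1ℚ :* (a :+ p) :+ :- a :* con 1ℚ := p) refl a p
  constant : 1ℚ * (a * a + p * a + q) + - a * (a + p) ≡ q
  constant = solve 3 (λ a p q → con 1ℚ :* (a :* a :+ p :* a :+ q) :+ :- a :* (a :+ p) := q) refl a p q
  unit : - a * (a * a + p * a + q) ≡ r
  unit = begin
    - a * (a * a + p * a + q)
      ≡⟨ solve 4 (λ a p q r → :- a :* (a :* a :+ p :* a :+ q) :=
                   r :+ :- (a :* a :* a :+ p :* a :* a :+ q :* a :+ r)) refl a p q r ⟩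
    r + - (a * a * a + p * a * a + q * a + r)
      ≡⟨ cong (λ c → r + - c) value≡0 ⟩
    r + - 0ℚ
      ≡⟨ +-identityʳ r ⟩
    r ∎

-- Elements of K k₀ with coordinates polynomial in twelve rational variables: the
-- coordinates of three elements x, y, z and the structure constants s₀, s₁, s₂ of
-- α³ = s₂ α² + s₁ α + s₀.  Evaluated at an assignment, each ring law of K k₀
-- becomes three identities of rational polynomials.
module Symbolic where
  open +-*-Solver using (Polynomial; con; var; _:+_; _:*_; :-_)

  record KExpr : Set where
    constructor ⟪_,_,_⟫
    field
      e₀ e₁ e₂ : Polynomial 12

  s₀ s₁ s₂ : Polynomial 12
  s₀ = var (suc (suc (suc (suc (suc (suc (suc (suc (suc zero)))))))))
  s₁ = var (suc (suc (suc (suc (suc (suc (suc (suc (suc (suc zero))))))))))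
  s₂ = var (suc (suc (suc (suc (suc (suc (suc (suc (suc (suc (suc zero)))))))))))

  x y z : KExpr
  x = ⟪ var zero , var (suc zero) , var (suc (suc zero)) ⟫
  y = ⟪ var (suc (suc (suc zero))) , var (suc (suc (suc (suc zero))))
      , var (suc (suc (suc (suc (suc zero))))) ⟫
  z = ⟪ var (suc (suc (suc (suc (suc (suc zero))))))
      , var (suc (suc (suc (suc (suc (suc (suc zero)))))))
      , var (suc (suc (suc (suc (suc (suc (suc (suc zero)))))))) ⟫

  embᵉ : Polynomial 12 → KExpr
  embᵉ a = ⟪ a , con 0ℚ , con 0ℚ ⟫

  _⊕ᵉ_ : KExpr → KExpr → KExpr
  ⟪ a₀ , a₁ , a₂ ⟫ ⊕ᵉ ⟪ b₀ , b₁ , b₂ ⟫ = ⟪ a₀ :+ b₀ , a₁ :+ b₁ , a₂ :+ b₂ ⟫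

  ⊖ᵉ_ : KExpr → KExpr
  ⊖ᵉ ⟪ a₀ , a₁ , a₂ ⟫ = ⟪ :- a₀ , :- a₁ , :- a₂ ⟫

  _⊗ᵉ_ : KExpr → KExpr → KExpr
  ⟪ a₀ , a₁ , a₂ ⟫ ⊗ᵉ ⟪ b₀ , b₁ , b₂ ⟫ =
    ⟪ d₀ :+ s₀ :* e₃ , d₁ :+ s₀ :* d₄ :+ s₁ :* e₃ , d₂ :+ s₁ :* d₄ :+ s₂ :* e₃ ⟫
    where
    d₀ d₁ d₂ d₃ d₄ e₃ : Polynomial 12
    d₀ = a₀ :* b₀
    d₁ = a₀ :* b₁ :+ a₁ :* b₀
    d₂ = a₀ :* b₂ :+ a₁ :* b₁ :+ a₂ :* b₀
    d₃ = a₁ :* b₂ :+ a₂ :* b₁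
    d₄ = a₂ :* b₂
    e₃ = d₃ :+ s₂ :* d₄

  infixl 6 _⊕ᵉ_
  infixl 7 _⊗ᵉ_

module _ (k₀ : ℚ) where
  open Field k₀

  module _ where
    open Symbolic
    open +-*-Solver using (con; _:*_; ⟦_⟧; ⟦_⟧↓; prove)

    assignment : K k₀ → K k₀ → K k₀ → Vec ℚ 12
    assignment ⟨ a₀ , a₁ , a₂ ⟩ ⟨ b₀ , b₁ , b₂ ⟩ ⟨ c₀ , c₁ , c₂ ⟩ =
      a₀ ∷ a₁ ∷ a₂ ∷ b₀ ∷ b₁ ∷ b₂ ∷ c₀ ∷ c₁ ∷ c₂ ∷
      - MonicCubic.r (fam k₀) ∷ - MonicCubic.q (fam k₀) ∷ - MonicCubic.p (fam k₀) ∷ []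

    ⟦_⟧ᵉ : KExpr → Vec ℚ 12 → K k₀
    ⟦ ⟪ a₀ , a₁ , a₂ ⟫ ⟧ᵉ ρ = ⟨ ⟦ a₀ ⟧ ρ , ⟦ a₁ ⟧ ρ , ⟦ a₂ ⟧ ρ ⟩

    coordinatewise : ∀ ρ (l r : KExpr) → let open KExpr in
      ⟦ e₀ l ⟧↓ ρ ≡ ⟦ e₀ r ⟧↓ ρ → ⟦ e₁ l ⟧↓ ρ ≡ ⟦ e₁ r ⟧↓ ρ →
      ⟦ e₂ l ⟧↓ ρ ≡ ⟦ e₂ r ⟧↓ ρ → ⟦ l ⟧ᵉ ρ ≡ ⟦ r ⟧ᵉ ρ
    coordinatewise ρ ⟪ a₀ , a₁ , a₂ ⟫ ⟪ b₀ , b₁ , b₂ ⟫ h₀ h₁ h₂ =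
      cong₃ ⟨_,_,_⟩ (prove ρ a₀ b₀ h₀) (prove ρ a₁ b₁ h₁) (prove ρ a₂ b₂ h₂)

    ⊕-assoc : ∀ a b c → a ⊕ b ⊕ c ≡ a ⊕ (b ⊕ c)
    ⊕-assoc a b c = coordinatewise (assignment a b c) (x ⊕ᵉ y ⊕ᵉ z) (x ⊕ᵉ (y ⊕ᵉ z)) refl refl refl

    ⊕-comm : ∀ a b → a ⊕ b ≡ b ⊕ a
    ⊕-comm a b = coordinatewise (assignment a b a) (x ⊕ᵉ y) (y ⊕ᵉ x) refl refl refl

    ⊕-identityˡ : ∀ a → emb 0ℚ ⊕ a ≡ a
    ⊕-identityˡ a = coordinatewise (assignment a a a) (embᵉ (con 0ℚ) ⊕ᵉ x) x refl refl refl

    ⊕-identityʳ : ∀ a → a ⊕ emb 0ℚ ≡ a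
    ⊕-identityʳ a = coordinatewise (assignment a a a) (x ⊕ᵉ embᵉ (con 0ℚ)) x refl refl refl

    ⊖-inverseˡ : ∀ a → ⊖ a ⊕ a ≡ emb 0ℚ
    ⊖-inverseˡ a = coordinatewise (assignment a a a) (⊖ᵉ x ⊕ᵉ x) (embᵉ (con 0ℚ)) refl refl refl

    ⊖-inverseʳ : ∀ a → a ⊕ ⊖ a ≡ emb 0ℚ
    ⊖-inverseʳ a = coordinatewise (assignment a a a) (x ⊕ᵉ ⊖ᵉ x) (embᵉ (con 0ℚ)) refl refl refl

    ⊗-assoc : ∀ a b c → a ⊗ b ⊗ c ≡ a ⊗ (b ⊗ c)
    ⊗-assoc a b c = coordinatewise (assignment a b c) (x ⊗ᵉ y ⊗ᵉ z) (x ⊗ᵉ (y ⊗ᵉ z)) refl refl refl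

    ⊗-comm : ∀ a b → a ⊗ b ≡ b ⊗ a
    ⊗-comm a b = coordinatewise (assignment a b a) (x ⊗ᵉ y) (y ⊗ᵉ x) refl refl refl

    ⊗-identityˡ : ∀ a → emb 1ℚ ⊗ a ≡ a
    ⊗-identityˡ a = coordinatewise (assignment a a a) (embᵉ (con 1ℚ) ⊗ᵉ x) x refl refl refl

    ⊗-identityʳ : ∀ a → a ⊗ emb 1ℚ ≡ a
    ⊗-identityʳ a = coordinatewise (assignment a a a) (x ⊗ᵉ embᵉ (con 1ℚ)) x refl refl refl

    ⊗-distribˡ-⊕ : ∀ a b c → a ⊗ (b ⊕ c) ≡ a ⊗ b ⊕ a ⊗ c
    ⊗-distribˡ-⊕ a b c = coordinatewise (assignment a b c) (x ⊗ᵉ (y ⊕ᵉ z)) (x ⊗ᵉ y ⊕ᵉ x ⊗ᵉ z) refl refl refl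

    ⊗-distribʳ-⊕ : ∀ a b c → (b ⊕ c) ⊗ a ≡ b ⊗ a ⊕ c ⊗ a
    ⊗-distribʳ-⊕ a b c = coordinatewise (assignment a b c) ((y ⊕ᵉ z) ⊗ᵉ x) (y ⊗ᵉ x ⊕ᵉ z ⊗ᵉ x) refl refl refl

    emb-* : ∀ a b → emb (a * b) ≡ emb a ⊗ emb b
    emb-* a b = coordinatewise (assignment (emb a) (emb b) (emb a))
      (embᵉ (KExpr.e₀ x :* KExpr.e₀ y)) (embᵉ (KExpr.e₀ x) ⊗ᵉ embᵉ (KExpr.e₀ y)) refl refl refl

  isCommutativeRing : IsCommutativeRing _≡_ _⊕_ _⊗_ ⊖_ (emb 0ℚ) (emb 1ℚ)
  isCommutativeRing = record
    { isRing = record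
      { +-isAbelianGroup = record
        { isGroup = record
          { isMonoid = record
            { isSemigroup = record
              { isMagma = record { isEquivalence = isEquivalence ; ∙-cong = cong₂ _⊕_ }
              ; assoc = ⊕-assoc
              }
            ; identity = ⊕-identityˡ , ⊕-identityʳ
            }
          ; inverse = ⊖-inverseˡ , ⊖-inverseʳ
          ; ⁻¹-cong = cong ⊖_
          }
        ; comm = ⊕-comm
        }
      ; *-cong = cong₂ _⊗_
      ; *-assoc = ⊗-assoc
      ; *-identity = ⊗-identityˡ , ⊗-identityʳ
      ; distrib = ⊗-distribˡ-⊕ , ⊗-distribʳ-⊕
      }
    ; *-comm = ⊗-comm
    }

  commutativeRing : CommutativeRing _ _
  commutativeRing = record { isCommutativeRing = isCommutativeRing }

  emb-morphism : +-*-rawRing -Raw-AlmostCommutative⟶ fromCommutativeRing commutativeRing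
  emb-morphism = record
    { ⟦_⟧    = emb
    ; +-homo = λ _ _ → refl
    ; *-homo = emb-*
    ; -‿homo = λ _ → refl
    ; 0-homo = refl
    ; 1-homo = refl
    }

  module K-Solver = Algebra.Solver.Ring +-*-rawRing (fromCommutativeRing commutativeRing)
    emb-morphism (λ a b → map (cong emb) (dec⇒weaklyDec _≟_ a b))
  open K-Solver using (solve; _:=_; con; _:+_; _:-_; _:*_; :-_)

  ⊗-cancelʳ-unit : ∀ {t ω a b} → t ⊗ ω ≡ emb 1ℚ → a ⊗ ω ≡ b ⊗ ω → a ≡ b
  ⊗-cancelʳ-unit {t} {ω} {a} {b} tω≡1 aω≡bω = begin
    a                ≡⟨ sym (⊗-identityʳ a) ⟩
    a ⊗ emb 1ℚ       ≡⟨ cong (a ⊗_) (sym tω≡1) ⟩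
    a ⊗ (t ⊗ ω)      ≡⟨ regroup a ⟩
    a ⊗ ω ⊗ t        ≡⟨ cong (_⊗ t) aω≡bω ⟩
    b ⊗ ω ⊗ t        ≡⟨ sym (regroup b) ⟩
    b ⊗ (t ⊗ ω)      ≡⟨ cong (b ⊗_) tω≡1 ⟩
    b ⊗ emb 1ℚ       ≡⟨ ⊗-identityʳ b ⟩
    b                ∎
    where
    regroup : ∀ c → c ⊗ (t ⊗ ω) ≡ c ⊗ ω ⊗ t
    regroup c = solve 3 (λ c t ω → c :* (t :* ω) := c :* ω :* t) refl c t ω

  vieta-root : ∀ {p q r} ω u v → emb p ≡ ⊖ (ω ⊕ u ⊕ v) → emb q ≡ ω ⊗ u ⊕ u ⊗ v ⊕ v ⊗ ω →
               emb r ≡ ⊖ (ω ⊗ u ⊗ v) → IsRoot (cubic p q r) ω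
  vieta-root {p} {q} {r} ω u v hp hq hr = begin
    ω ⊗ ω ⊗ ω ⊕ emb p ⊗ ω ⊗ ω ⊕ emb q ⊗ ω ⊕ emb r
      ≡⟨ cong₃ (λ P Q R → ω ⊗ ω ⊗ ω ⊕ P ⊗ ω ⊗ ω ⊕ Q ⊗ ω ⊕ R) hp hq hr ⟩
    ω ⊗ ω ⊗ ω ⊕ ⊖ (ω ⊕ u ⊕ v) ⊗ ω ⊗ ω ⊕ (ω ⊗ u ⊕ u ⊗ v ⊕ v ⊗ ω) ⊗ ω ⊕ ⊖ (ω ⊗ u ⊗ v)
      ≡⟨ solve 3 (λ ω u v → ω :* ω :* ω :+ :- (ω :+ u :+ v) :* ω :* ω
                            :+ (ω :* u :+ u :* v :+ v :* ω) :* ω :+ :- (ω :* u :* v) := con 0ℚ)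
                 refl ω u v ⟩
    emb 0ℚ ∎

  module YOrbit (ω u v : K k₀) (uω≡ω-1 : u ⊗ ω ≡ ω ⊝ emb 1ℚ)
                (v[ω-1]≡-1 : v ⊗ (ω ⊝ emb 1ℚ) ≡ emb (- 1ℚ)) where

    product : ω ⊗ u ⊗ v ≡ emb (- 1ℚ)
    product = begin
      ω ⊗ u ⊗ v         ≡⟨ solve 3 (λ ω u v → ω :* u :* v := v :* (u :* ω)) refl ω u v ⟩
      v ⊗ (u ⊗ ω)       ≡⟨ cong (v ⊗_) uω≡ω-1 ⟩
      v ⊗ (ω ⊝ emb 1ℚ)  ≡⟨ v[ω-1]≡-1 ⟩
      emb (- 1ℚ)        ∎

    -- ω is a unit with inverse -uv, and (e₂ - e₁ + 3)·ω lies in the ideal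
    -- generated by the two defining relations.
    pair-sum : ω ⊗ u ⊕ u ⊗ v ⊕ v ⊗ ω ≡ ω ⊕ u ⊕ v ⊝ emb 3ℚ
    pair-sum = ⊗-cancelʳ-unit {t = ⊖ (u ⊗ v)} {ω = ω} ω-unit (begin
      (ω ⊗ u ⊕ u ⊗ v ⊕ v ⊗ ω) ⊗ ω
        ≡⟨ solve 3 (λ ω u v → (ω :* u :+ u :* v :+ v :* ω) :* ω :=
                     (ω :+ u :+ v :- con 3ℚ) :* ω :+ relationsₚ ω v (u :* ω) (v :* (ω :- con 1ℚ)))
                   refl ω u v ⟩
      (ω ⊕ u ⊕ v ⊝ emb 3ℚ) ⊗ ω ⊕ relations (u ⊗ ω) (v ⊗ (ω ⊝ emb 1ℚ))
        ≡⟨ cong₂ (λ U V → (ω ⊕ u ⊕ v ⊝ emb 3ℚ) ⊗ ω ⊕ relations U V) uω≡ω-1 v[ω-1]≡-1 ⟩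
      (ω ⊕ u ⊕ v ⊝ emb 3ℚ) ⊗ ω ⊕ relations (ω ⊝ emb 1ℚ) (emb (- 1ℚ))
        ≡⟨ solve 3 (λ ω u v → (ω :+ u :+ v :- con 3ℚ) :* ω :+ relationsₚ ω v (ω :- con 1ℚ) (con (- 1ℚ)) :=
                     (ω :+ u :+ v :- con 3ℚ) :* ω) refl ω u v ⟩
      (ω ⊕ u ⊕ v ⊝ emb 3ℚ) ⊗ ω ∎)
      where
      ω-unit : ⊖ (u ⊗ v) ⊗ ω ≡ emb 1ℚ
      ω-unit = trans (solve 3 (λ ω u v → :- (u :* v) :* ω := :- (ω :* u :* v)) refl ω u v)
                     (cong ⊖_ product)
      relations : K k₀ → K k₀ → K k₀
      relations U V = (ω ⊕ v ⊝ emb 1ℚ) ⊗ (U ⊝ (ω ⊝ emb 1ℚ)) ⊕ (ω ⊕ emb 1ℚ) ⊗ (V ⊝ emb (- 1ℚ))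
      relationsₚ : (ω v U V : K-Solver.Polynomial 3) → K-Solver.Polynomial 3
      relationsₚ ω v U V = (ω :+ v :- con 1ℚ) :* (U :- (ω :- con 1ℚ)) :+ (ω :+ con 1ℚ) :* (V :- con (- 1ℚ))

  -- With E = emb k the cubic reads ω³ - E ω² + (E - 3) ω + 1, so
  -- ω⁻¹ = -(ω² - E ω + E - 3) and u = 1 - ω⁻¹ is y(ω); v is forced by the trace.
  module RootOrbit (k : ℚ) (ω : K k₀) (root : IsRoot (fam k) ω) where

    u v : K k₀
    u = emb 1ℚ ⊕ (ω ⊗ ω ⊝ emb k ⊗ ω ⊕ emb (k - 3ℚ))
    v = emb k ⊝ ω ⊝ u

    uₚ cubicₚ : K-Solver.Polynomial 2 → K-Solver.Polynomial 2 → K-Solver.Polynomial 2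
    uₚ ω E = con 1ℚ :+ (ω :* ω :- E :* ω :+ (E :- con 3ℚ))
    cubicₚ ω E = ω :* ω :* ω :+ :- E :* ω :* ω :+ (E :- con 3ℚ) :* ω :+ con 1ℚ

    uω≡ω-1 : u ⊗ ω ≡ ω ⊝ emb 1ℚ
    uω≡ω-1 = begin
      u ⊗ ω
        ≡⟨ solve 2 (λ ω E → uₚ ω E :* ω := cubicₚ ω E :+ (ω :- con 1ℚ)) refl ω (emb k) ⟩
      ω ⊗ ω ⊗ ω ⊕ emb (- k) ⊗ ω ⊗ ω ⊕ emb (k - 3ℚ) ⊗ ω ⊕ emb 1ℚ ⊕ (ω ⊝ emb 1ℚ)
        ≡⟨ cong (_⊕ (ω ⊝ emb 1ℚ)) root ⟩
      emb 0ℚ ⊕ (ω ⊝ emb 1ℚ)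
        ≡⟨ ⊕-identityˡ (ω ⊝ emb 1ℚ) ⟩
      ω ⊝ emb 1ℚ ∎

    v[ω-1]≡-1 : v ⊗ (ω ⊝ emb 1ℚ) ≡ emb (- 1ℚ)
    v[ω-1]≡-1 = begin
      v ⊗ (ω ⊝ emb 1ℚ)
        ≡⟨ solve 2 (λ ω E → (E :- ω :- uₚ ω E) :* (ω :- con 1ℚ) := :- cubicₚ ω E :- con 1ℚ)
                   refl ω (emb k) ⟩
      ⊖ (ω ⊗ ω ⊗ ω ⊕ emb (- k) ⊗ ω ⊗ ω ⊕ emb (k - 3ℚ) ⊗ ω ⊕ emb 1ℚ) ⊝ emb 1ℚ
        ≡⟨ cong (λ c → ⊖ c ⊝ emb 1ℚ) root ⟩
      emb (- 1ℚ) ∎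

    trace : ω ⊕ u ⊕ v ≡ emb k
    trace = solve 2 (λ ω E → ω :+ uₚ ω E :+ (E :- ω :- uₚ ω E) := E) refl ω (emb k)

  emb-value : ∀ p q r a → emb (a * a * a + p * a * a + q * a + r) ≡
              emb a ⊗ emb a ⊗ emb a ⊕ emb p ⊗ emb a ⊗ emb a ⊕ emb q ⊗ emb a ⊕ emb r
  emb-value p q r a =
    cong (_⊕ emb r) (cong₂ _⊕_ (cong₂ _⊕_ (emb-*³ a a a) (emb-*³ p a a)) (emb-* q a))
    where
    emb-*³ : ∀ b c d → emb (b * c * d) ≡ emb b ⊗ emb c ⊗ emb d
    emb-*³ b c d = trans (emb-* (b * c) d) (cong (_⊗ emb d) (emb-* b c))

  no-rational-root : ∀ P a → Irreducible P → ¬ IsRoot P (emb a)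
  no-rational-root (cubic p q r) a irreducible root =
    root⇒reducible p q r a (cong K.c₀ (trans (emb-value p q r a) root)) irreducible

  y-class→root : ∀ ω → YClass ω → Σ ℚ λ k → Irreducible (fam k) × IsRoot (fam k) ω
  y-class→root ω (_ , u , v , uω≡ω-1 , v[ω-1]≡-1 , cubic p q r , irreducible , hp , hq , hr) =
    - p , subst (λ P → Irreducible P × IsRoot P ω) P≡fam (irreducible , vieta-root ω u v hp hq hr)
    where
    open YOrbit ω u v uω≡ω-1 v[ω-1]≡-1
    open RingProperties (CommutativeRing.ring commutativeRing) using () renaming (-‿involutive to ⊖-involutive)
    trace≡-p : ω ⊕ u ⊕ v ≡ emb (- p)
    trace≡-p = trans (sym (⊖-involutive (ω ⊕ u ⊕ v))) (cong ⊖_ (sym hp))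
    P≡fam : cubic p q r ≡ fam (- p)
    P≡fam = cong₃ cubic (sym (neg-involutive p))
      (cong K.c₀ (trans hq (trans pair-sum (cong (_⊝ emb 3ℚ) trace≡-p))))
      (cong K.c₀ (trans hr (cong ⊖_ product)))

  root→y-class : ∀ ω → (Σ ℚ λ k → Irreducible (fam k) × IsRoot (fam k) ω) → YClass ω
  root→y-class ω (k , irreducible , root) =
    not-rational , u , v , uω≡ω-1 , v[ω-1]≡-1 , fam k , irreducible ,
    cong ⊖_ (sym trace) ,
    sym (trans pair-sum (cong (_⊝ emb 3ℚ) trace)) ,
    cong ⊖_ (sym product)
    where
    open RootOrbit k ω root
    open YOrbit ω u v uω≡ω-1 v[ω-1]≡-1
    not-rational : ¬ (Σ ℚ λ a → ω ≡ emb a)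
    not-rational (a , ω≡a) = no-rational-root (fam k) a irreducible (subst (IsRoot (fam k)) ω≡a root)

mainTheorem1 : (k₀ : ℚ) → Irreducible (fam k₀) → (ω : K k₀) →
    Field.YClass k₀ ω ⇔ (Σ ℚ λ k → Irreducible (fam k) × Field.IsRoot k₀ (fam k) ω)
mainTheorem1 k₀ _ ω = mk⇔ (y-class→root k₀ ω) (root→y-class k₀ ω)
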